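{- A matroidal binary function is linear if and only if it has no minor isomorphic to $f_{\mathcal{U}_{2,4}}\colon 2^{\{a,b,c,d\}}\to\mathbb{R}$, where $f_{\mathcal{U}_{2,4}}(X)=0$ if $|X|\in\{1,2\}$, $f_{\mathcal{U}_{2,4}}(X)=1$ if $|X|\in\{0,3\}$, and $f_{\mathcal{U}_{2,4}}(X)=-1$ if $|X|=4$.
   Context: A binary function on a finite ground set $E$ is a function $f\colon 2^E\to\mathbb{R}$ with $f(\emptyset)=1$. Its rank function $Qf\colon 2^E\to\mathbb{R}$ is $Qf(X)=\log_2\left(\frac{\sum_{Y\subseteq E} f(Y)}{\sum_{Y\subseteq E\setminus X} f(Y)}\right)$; $f$ is rankable if $Qf(X)$ is well defined for every $X\subseteq E$. The binary function $f$ is matroidal if it is rankable and $Qf$ is a matroid rank function: $Qf(X)$ is a nonnegative integer with $Qf(X)\leq|X|$ for all $X\subseteq E$, $Qf(X)\leq Qf(X\cup\{e\})$ for all $X\subseteq E$, $e\in E\setminus X$, and $Qf(X)+Qf(X\cup\{a,b\})\leq Qf(X\cup\{a\})+Qf(X\cup\{b\})$ for all $X\subseteq E$ and distinct $a,b\in E\setminus X$. A binary function $f$ is linear if it is $\{0,1\}$-valued and for all $X,Y\subseteq E$, $f(X)=f(Y)=1$ implies $f(X\triangle Y)=1$. For $X\subseteq E$, the contraction $f/X\colon 2^{E\setminus X}\to\mathbb{R}$ is $f/X(Y)=f(Y)$, and the deletion $f\setminus X\colon 2^{E\setminus X}\to\mathbb{R}$ is $f\setminus X(Y)=\frac{\sum_{Z\subseteq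 X} f(Y\cup Z)}{\sum_{Z\subseteq X} f(Z)}$, well defined exactly when the denominator is nonzero. A minor of $f$ is a well-defined binary function $(f/X)\setminus Y$ for disjoint $X,Y\subseteq E$. Two binary functions $f$ on $E$ and $f'$ on $E'$ are isomorphic if there is a bijection $\phi\colon E\to E'$ with $f(X)=f'(\phi(X))$ for all $X\subseteq E$. -}

module Defs where

open import Level using (0ℓ)
open import Data.Bool using (Bool; true; false; _xor_; if_then_else_)
open import Data.Nat as ℕ using (ℕ; zero; suc; _^_)
open import Data.Fin using (Fin; zero; suc)
open import Data.Vec using (Vec; []; _∷_; zipWith)
open import Data.Fin.Subset using (Subset; ⊥; ⁅_⁆; _∪_; _∩_; _∈_; _∉_; ∣_∣)
open import Data.Product using (Σ; ∃; _×_; _,_)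
open import Data.Sum using (_⊎_)
open import Relation.Binary.PropositionalEquality using (_≡_)
open import Relation.Binary.Core using (Rel)
open import Relation.Nullary using (¬_)
open import Algebra.Structures using (IsCommutativeRing)
open import Relation.Binary.Structures using (IsStrictTotalOrder)
open import Function.Definitions using (Injective)

-- The real numbers, axiomatised as a complete ordered field
-- (any such structure is isomorphic to ℝ).  The theorem quantifies over
-- every such structure.

record RealField : Set₁ where
  infixl 6 _+_
  infixl 7 _*_
  infix 4 _<_ _≤_
  field
    Carrier : Set
    0# 1#   : Carrier
    _+_ _*_ : Carrier → Carrier → Carrier
    -_      : Carrier → Carrier
    _⁻¹     : Carrier → Carrier
    _<_     : Rel Carrier 0ℓ
    isCommutativeRing   : IsCommutativeRing _≡_ _+_ _*_ -_ 0# 1#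
    0≢1                 : ¬ (0# ≡ 1#)
    ⁻¹-inverse          : ∀ x → ¬ (x ≡ 0#) → x * (x ⁻¹) ≡ 1#
    isStrictTotalOrder  : IsStrictTotalOrder _≡_ _<_
    +-mono-<            : ∀ {x y} z → x < y → x + z < y + z
    *-pos               : ∀ {x y} → 0# < x → 0# < y → 0# < x * y

  _≤_ : Rel Carrier 0ℓ
  x ≤ y = x < y ⊎ x ≡ y

  field
    complete : (P : Carrier → Set) → ∃ P → ∃ (λ b → ∀ x → P x → x ≤ b) →
               ∃ (λ s → (∀ x → P x → x ≤ s) × (∀ b → (∀ x → P x → x ≤ b) → s ≤ b))

  fromℕ : ℕ → Carrier
  fromℕ zero    = 0#
  fromℕ (suc n) = 1# + fromℕ n

_△_ : ∀ {n} → Subset n → Subset n → Subset n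
_△_ = zipWith _xor_

image : ∀ {m n} → (Fin m → Fin n) → Subset m → Subset n
image {zero}  φ []      = ⊥
image {suc m} φ (b ∷ W) = (if b then ⁅ φ zero ⁆ else ⊥) ∪ image (λ i → φ (suc i)) W

module _ (ℝ : RealField) where
  open RealField ℝ

  sumSub : ∀ {n} → Subset n → (Subset n → Carrier) → Carrier
  sumSub []          h = h []
  sumSub (false ∷ S) h = sumSub S (λ Y → h (false ∷ Y))
  sumSub (true  ∷ S) h = sumSub S (λ Y → h (false ∷ Y)) + sumSub S (λ Y → h (true ∷ Y))

  full : ∀ {n} → Subset n
  full {zero}  = []
  full {suc n} = true ∷ full

  compl : ∀ {n} → Subset n → Subset n
  compl []      = []
  compl (b ∷ X) = (if b then false else true) ∷ compl X

  IsBinaryFunction : ∀ {n} → (Subset n → Carrier) → Set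
  IsBinaryFunction f = f ⊥ ≡ 1#

  -- Matroidal: Qf(X) = log₂(Σ_{Y⊆E} f Y / Σ_{Y⊆E∖X} f Y) is well defined and
  -- equals r X for a matroid rank function r : Subset n → ℕ.
  -- (log₂ q = k for an integer k means q = 2^k.)
  IsMatroidRank : ∀ {n} → (Subset n → ℕ) → Set
  IsMatroidRank {n} r =
      (∀ X → r X ℕ.≤ ∣ X ∣)
    × (∀ X e → e ∉ X → r X ℕ.≤ r (X ∪ ⁅ e ⁆))
    × (∀ X a b → a ∉ X → b ∉ X → ¬ (a ≡ b) →
         r X ℕ.+ r (X ∪ ⁅ a ⁆ ∪ ⁅ b ⁆) ℕ.≤ r (X ∪ ⁅ a ⁆) ℕ.+ r (X ∪ ⁅ b ⁆))

  Matroidal : ∀ {n} → (Subset n → Carrier) → Set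
  Matroidal {n} f =
    Σ (Subset n → ℕ) λ r →
        (∀ X → ¬ (sumSub (compl X) f ≡ 0#)
             × (sumSub full f * (sumSub (compl X) f) ⁻¹ ≡ fromℕ (2 ^ r X)))
      × IsMatroidRank r

  Linear : ∀ {n} → (Subset n → Carrier) → Set
  Linear f = (∀ X → f X ≡ 0# ⊎ f X ≡ 1#)
           × (∀ X Y → f X ≡ 1# → f Y ≡ 1# → f (X △ Y) ≡ 1#)

  -- (f/X)∖Y evaluated at W ⊆ E∖(X∪Y):  Σ_{Z⊆Y} f(W∪Z) / Σ_{Z⊆Y} f(Z)
  contractDelete : ∀ {n} → (Subset n → Carrier) → Subset n → Subset n → Carrier
  contractDelete f Y W = sumSub Y (λ Z → f (W ∪ Z)) * (sumSub Y f) ⁻¹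

  HasMinorIsoTo : ∀ {n m} → (Subset n → Carrier) → (Subset m → Carrier) → Set
  HasMinorIsoTo {n} {m} f g =
    Σ (Subset n) λ X → Σ (Subset n) λ Y →
      (X ∩ Y ≡ ⊥)
    × ¬ (sumSub Y f ≡ 0#)
    × Σ (Fin m → Fin n) λ φ →
        Injective _≡_ _≡_ φ
      × (∀ i → φ i ∉ X × φ i ∉ Y)
      × (∀ e → e ∉ X → e ∉ Y → ∃ λ i → φ i ≡ e)
      × (∀ W → g W ≡ contractDelete f Y (image φ W))

  u24val : ℕ → Carrier
  u24val 0 = 1#
  u24val 1 = 0#
  u24val 2 = 0#
  u24val 3 = 1#
  u24val _ = - 1#

  fU24 : Subset 4 → Carrier
  fU24 X = u24val ∣ X ∣

{-# OPTIONS --safe #-}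
module Submission where

-- A linear function is nonnegative, so its minors never take the value -1.
--
-- Conversely, write h for the minor obtained by deleting B, restricted to the
-- subsets of A, and argue by induction on |A| for all B.  If some e in A is a
-- loop (h e = 1), then h (W ∪ e) = h W by supermodularity, so e may be dropped.
-- Otherwise deleting e gives g W = h W + h (W ∪ e), and both g and h are linear
-- on A ∖ e.  If h is 0/1-valued this forces h to be linear on A.  If not, then
-- h A = -1 and h (A ∖ e) = 1 for all e; linearity of each g then makes h vanish
-- on pairs and equal 1 on triples, and a fifth element of A is impossible
-- because two triples would sum to a pair.  Hence |A| = 4 and h is f_{U₂,₄}.

open import Defs
open import Algebra.Bundles using (CommutativeRing; CommutativeMonoid)
import Algebra.Properties.CommutativeSemigroup as CommutativeSemigroupProperties
import Algebra.Properties.Group as GroupProperties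
import Algebra.Properties.Ring as RingProperties
open import Data.Bool as Bool using (Bool; true; false; T; not; _xor_)
open import Data.Bool.Properties using (T-∧)
open import Data.Fin as Fin using (Fin; zero; suc)
open import Data.Fin.Patterns using (0F; 1F; 2F; 3F; 4F; 5F)
import Data.Fin.Properties as Finₚ
open import Data.Fin.Subset using (Subset; ⊥; ⊤; ⁅_⁆; ∁; _∪_; _∩_; _∈_; _∉_; ∣_∣)
open import Data.Fin.Subset.Properties using (_∈?_; nonempty?; Empty-unique; ∉⊥; x∈⁅x⁆; x∈⁅y⁆⇒x≡y; ∪-identityˡ; ∪-identityʳ; ⊆-antisym; p∩q⊆p; x∈p∩q⁺; x∈p∩q⁻; p⊂q⇒∣p∣<∣q∣; drop-there; ∣⁅x⁆∣≡1; ∩-identityʳ; ∩-zeroʳ)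
open import Data.List using (List; []; _∷_)
open import Data.List.Relation.Unary.All using (All; []; _∷_)
open import Data.Nat as ℕ using (ℕ; zero; suc; _^_)
import Data.Nat.Properties as ℕₚ
open import Data.Product using (∃; _×_; _,_; proj₁; proj₂)
open import Data.Sum using (_⊎_; inj₁; inj₂)
open import Data.Vec as Vec using (Vec; []; _∷_; lookup; here; there)
open import Data.Vec.Properties using (lookup-map; lookup-zipWith; lookup-replicate; tabulate∘lookup; tabulate-cong)
open import Function using (_∘_; Equivalence)
open import Level using (0ℓ)
open import Relation.Binary.Definitions using (tri<; tri≈; tri>)
open import Relation.Binary.PropositionalEquality using (_≡_; _≢_; refl; sym; trans; cong; cong₂; subst; module ≡-Reasoning)
open import Relation.Binary.Structures using (IsStrictTotalOrder)
open import Relation.Nullary using (¬_; yes; no; contradiction)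
open import Relation.Nullary.Decidable using (_×-dec_)

private
  variable
    k n : ℕ

-- Equations between subsets

lookup-ext : ∀ {X Y : Subset n} → (∀ i → lookup X i ≡ lookup Y i) → X ≡ Y
lookup-ext {X = X} {Y} eq =
  trans (sym (tabulate∘lookup X)) (trans (tabulate-cong eq) (tabulate∘lookup Y))

infix  9 ~_
infixl 8 _∧_
infixl 7 _∨_ _⊕_
infix  6 _≐_ _≼_ _⋕_

data Expr (k : ℕ) : Set where
  var         : Fin k → Expr k
  ∅           : Expr k
  ~_          : Expr k → Expr k
  _∧_ _∨_ _⊕_ : Expr k → Expr k → Expr k

data Equation (k : ℕ) : Set where
  _≐_ : Expr k → Expr k → Equation k

-- Inclusion and disjointness are encoded as equations, so that `solve` meets a single kind of
-- hypothesis and goal.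
_≼_ _⋕_ : Expr k → Expr k → Equation k
s ≼ t = s ∧ t ≐ s
s ⋕ t = s ∧ t ≐ ∅

⟦_⟧ : Expr k → Vec (Subset n) k → Subset n
⟦ var i ⟧ ρ = lookup ρ i
⟦ ∅ ⟧     ρ = ⊥
⟦ ~ s ⟧   ρ = ∁ (⟦ s ⟧ ρ)
⟦ s ∧ t ⟧ ρ = ⟦ s ⟧ ρ ∩ ⟦ t ⟧ ρ
⟦ s ∨ t ⟧ ρ = ⟦ s ⟧ ρ ∪ ⟦ t ⟧ ρ
⟦ s ⊕ t ⟧ ρ = ⟦ s ⟧ ρ △ ⟦ t ⟧ ρ

⟦_⟧ᵇ : Expr k → Vec Bool k → Bool
⟦ var i ⟧ᵇ v = lookup v i
⟦ ∅ ⟧ᵇ     v = false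
⟦ ~ s ⟧ᵇ   v = not (⟦ s ⟧ᵇ v)
⟦ s ∧ t ⟧ᵇ v = ⟦ s ⟧ᵇ v Bool.∧ ⟦ t ⟧ᵇ v
⟦ s ∨ t ⟧ᵇ v = ⟦ s ⟧ᵇ v Bool.∨ ⟦ t ⟧ᵇ v
⟦ s ⊕ t ⟧ᵇ v = ⟦ s ⟧ᵇ v xor ⟦ t ⟧ᵇ v

Holds : Vec (Subset n) k → Equation k → Set
Holds ρ (s ≐ t) = ⟦ s ⟧ ρ ≡ ⟦ t ⟧ ρ

holdsᵇ : Vec Bool k → Equation k → Bool
holdsᵇ v (s ≐ t) = not (⟦ s ⟧ᵇ v xor ⟦ t ⟧ᵇ v)

impliesᵇ : List (Equation k) → Equation k → Vec Bool k → Bool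
impliesᵇ []       g v = holdsᵇ v g
impliesᵇ (e ∷ es) g v = not (holdsᵇ v e) Bool.∨ impliesᵇ es g v

everywhere : ∀ k → (Vec Bool k → Bool) → Bool
everywhere zero    p = p []
everywhere (suc k) p = everywhere k (p ∘ (false ∷_)) Bool.∧ everywhere k (p ∘ (true ∷_))

everywhere-sound : ∀ {k} (p : Vec Bool k → Bool) → T (everywhere k p) → ∀ v → T (p v)
everywhere-sound p t []          = t
everywhere-sound p t (false ∷ v) = everywhere-sound _ (proj₁ (Equivalence.to T-∧ t)) v
everywhere-sound p t (true  ∷ v) = everywhere-sound _ (proj₂ (Equivalence.to T-∧ t)) v

xnor-refl : ∀ {a b} → a ≡ b → not (a xor b) ≡ true
xnor-refl {false} refl = refl
xnor-refl {true}  refl = refl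

xnor-sound : ∀ a b → T (not (a xor b)) → a ≡ b
xnor-sound false false _ = refl
xnor-sound true  true  _ = refl

module _ (ρ : Vec (Subset n) k) (i : Fin n) where

  column : Vec Bool k
  column = Vec.map (λ X → lookup X i) ρ

  lookup-⟦⟧ : ∀ s → lookup (⟦ s ⟧ ρ) i ≡ ⟦ s ⟧ᵇ column
  lookup-⟦⟧ (var j) = sym (lookup-map j _ ρ)
  lookup-⟦⟧ ∅       = lookup-replicate i false
  lookup-⟦⟧ (~ s)   = trans (lookup-map i not (⟦ s ⟧ ρ)) (cong not (lookup-⟦⟧ s))
  lookup-⟦⟧ (s ∧ t) = trans (lookup-zipWith _ i (⟦ s ⟧ ρ) (⟦ t ⟧ ρ)) (cong₂ Bool._∧_ (lookup-⟦⟧ s) (lookup-⟦⟧ t))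
  lookup-⟦⟧ (s ∨ t) = trans (lookup-zipWith _ i (⟦ s ⟧ ρ) (⟦ t ⟧ ρ)) (cong₂ Bool._∨_ (lookup-⟦⟧ s) (lookup-⟦⟧ t))
  lookup-⟦⟧ (s ⊕ t) = trans (lookup-zipWith _ i (⟦ s ⟧ ρ) (⟦ t ⟧ ρ)) (cong₂ _xor_ (lookup-⟦⟧ s) (lookup-⟦⟧ t))

  holds⇒holdsᵇ : ∀ e → Holds ρ e → holdsᵇ column e ≡ true
  holds⇒holdsᵇ (s ≐ t) h =
    xnor-refl (trans (sym (lookup-⟦⟧ s)) (trans (cong (λ X → lookup X i) h) (lookup-⟦⟧ t)))

  impliesᵇ-sound : ∀ es s t → All (Holds ρ) es → T (impliesᵇ es (s ≐ t) column) →
                   lookup (⟦ s ⟧ ρ) i ≡ lookup (⟦ t ⟧ ρ) i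
  impliesᵇ-sound []       s t []       p =
    trans (lookup-⟦⟧ s) (trans (xnor-sound _ _ p) (sym (lookup-⟦⟧ t)))
  impliesᵇ-sound (e ∷ es) s t (h ∷ hs) p =
    -- With the antecedent rewritten to `true`, the disjunction computes to its second half.
    impliesᵇ-sound es s t hs (subst (λ b → T (not b Bool.∨ _)) (holds⇒holdsᵇ e h) p)

-- Set algebra is pointwise, so an implication between equations need only be
-- checked on the 2ᵏ truth assignments.
solve : (ρ : Vec (Subset n) k) (es : List (Equation k)) (g : Equation k)
        {_ : T (everywhere k (impliesᵇ es g))} → All (Holds ρ) es → Holds ρ g
solve ρ es (s ≐ t) {valid} hs =
  lookup-ext λ i → impliesᵇ-sound ρ i es s t hs (everywhere-sound _ valid (column ρ i))

a : Expr (suc k)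
a = var 0F

b : Expr (suc (suc k))
b = var 1F

c : Expr (3 ℕ.+ k)
c = var 2F

d : Expr (4 ℕ.+ k)
d = var 3F

e′ : Expr (5 ℕ.+ k)
e′ = var 4F

-- Inclusion and disjointness of subsets

infix 4 _⊑_ _#_
infixl 7 _∖_

-- These unfold to the equations behind `_≼_` and `_⋕_`, so results of `solve` have these types
-- without conversion.
_⊑_ _#_ : Subset n → Subset n → Set
X ⊑ Y = X ∩ Y ≡ X
X # Y = X ∩ Y ≡ ⊥

_∖_ : Subset n → Subset n → Subset n
X ∖ Y = X ∩ ∁ Y

∈⇒⊑ : ∀ {i : Fin n} {X} → i ∈ X → ⁅ i ⁆ ⊑ X
∈⇒⊑ {i = i} {X} i∈X = ⊆-antisym (p∩q⊆p ⁅ i ⁆ X)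
  λ j∈i → x∈p∩q⁺ (j∈i , subst (_∈ X) (sym (x∈⁅y⁆⇒x≡y i j∈i)) i∈X)

⊑⇒∈ : ∀ {i : Fin n} {X} → ⁅ i ⁆ ⊑ X → i ∈ X
⊑⇒∈ {i = i} {X} i⊑X = proj₂ (x∈p∩q⁻ ⁅ i ⁆ X (subst (i ∈_) (sym i⊑X) (x∈⁅x⁆ i)))

∉⇒# : ∀ {i : Fin n} {X} → i ∉ X → ⁅ i ⁆ # X
∉⇒# {i = i} {X} i∉X = Empty-unique λ (j , j∈) →
  let j∈i , j∈X = x∈p∩q⁻ ⁅ i ⁆ X j∈ in i∉X (subst (_∈ X) (x∈⁅y⁆⇒x≡y i j∈i) j∈X)

#⇒∉ : ∀ {i : Fin n} {X} → ⁅ i ⁆ # X → i ∉ X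
#⇒∉ {i = i} i#X i∈X = ∉⊥ (subst (i ∈_) i#X (x∈p∩q⁺ (x∈⁅x⁆ i , i∈X)))

≢⇒# : ∀ {i j : Fin n} → i ≢ j → ⁅ i ⁆ # ⁅ j ⁆
≢⇒# i≢j = ∉⇒# (i≢j ∘ x∈⁅y⁆⇒x≡y _)

#⇒≢ : ∀ {i j : Fin n} → ⁅ i ⁆ # ⁅ j ⁆ → i ≢ j
#⇒≢ {i = i} i#j refl = #⇒∉ i#j (x∈⁅x⁆ i)

-- To `solve` a singleton is an arbitrary set; this dichotomy brings in that it is an atom.
atom? : ∀ (i : Fin n) X → ⁅ i ⁆ ⊑ X ⊎ ⁅ i ⁆ # X
atom? i X with i ∈? X
... | yes i∈X = inj₁ (∈⇒⊑ i∈X)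
... | no  i∉X = inj₂ (∉⇒# i∉X)

inhabited? : ∀ (X : Subset n) → X ≡ ⊥ ⊎ ∃ λ i → ⁅ i ⁆ ⊑ X
inhabited? X with nonempty? X
... | yes (i , i∈X) = inj₂ (i , ∈⇒⊑ i∈X)
... | no  empty     = inj₁ (Empty-unique empty)

∣∖∣<∣∣ : ∀ (X : Subset n) i → ⁅ i ⁆ ⊑ X → ∣ X ∖ ⁅ i ⁆ ∣ ℕ.< ∣ X ∣
∣∖∣<∣∣ X i i⊑X = p⊂q⇒∣p∣<∣q∣ (p∩q⊆p X _ , i , ⊑⇒∈ i⊑X ,
  #⇒∉ {X = X ∖ ⁅ i ⁆} (solve (⁅ i ⁆ ∷ X ∷ []) [] (a ⋕ b ∧ ~ a) []))

subset-induction : ∀ {n} (P : Subset n → Set) → P ⊥ →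
                   (∀ i X → i ∉ X → P X → P (X ∪ ⁅ i ⁆)) → ∀ X → P X
subset-induction P base step []      = base
subset-induction P base step (s ∷ X) = add s
  where
  without : P (false ∷ X)
  without = subset-induction (P ∘ (false ∷_)) base
    (λ i Y i∉Y → step (suc i) (false ∷ Y) (i∉Y ∘ drop-there)) X
  add : ∀ s → P (s ∷ X)
  add false = without
  add true  = subst (λ Y → P (true ∷ Y)) (∪-identityʳ X) (step zero (false ∷ X) (λ ()) without)

compl≡∁ : ∀ ℝ (X : Subset n) → compl ℝ X ≡ ∁ X
compl≡∁ ℝ []          = refl
compl≡∁ ℝ (false ∷ X) = cong (true ∷_) (compl≡∁ ℝ X)
compl≡∁ ℝ (true  ∷ X) = cong (false ∷_) (compl≡∁ ℝ X)

compl-∁ : ∀ ℝ (X : Subset n) → compl ℝ (∁ X) ≡ X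
compl-∁ ℝ X = trans (compl≡∁ ℝ (∁ X)) (solve (X ∷ []) [] (~ ~ a ≐ a) [])

-- Ordered fields

module RealProperties (ℝ : RealField) where
  open RealField ℝ public
  open IsStrictTotalOrder isStrictTotalOrder public using (compare; _≟_) renaming (trans to <-trans; irrefl to <-irrefl)

  commutativeRing : CommutativeRing 0ℓ 0ℓ
  commutativeRing = record { isCommutativeRing = isCommutativeRing }

  open CommutativeRing commutativeRing public
    using (+-comm; +-assoc; +-identityˡ; +-identityʳ; -‿inverseʳ; *-comm; *-assoc; *-identityˡ; *-identityʳ; distribˡ; distribʳ; zeroˡ; ring; +-group; +-commutativeMonoid)
  open RingProperties ring public using (-1*x≈-x)
  open GroupProperties +-group public using () renaming (∙-cancelˡ to +-cancelˡ; inverseʳ-unique to +-inverseʳ-unique; ⁻¹-involutive to -‿involutive)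
  open CommutativeSemigroupProperties (CommutativeMonoid.commutativeSemigroup +-commutativeMonoid) public using () renaming (interchange to +-interchange)

  0<1 : 0# < 1#
  0<1 with compare 0# 1#
  ... | tri< 0<1 _ _ = 0<1
  ... | tri≈ _ 0≡1 _ = contradiction 0≡1 0≢1
  -- If 1 were negative, then -1 would be positive, and so would its square, which is 1.
  ... | tri> _ _ 1<0 = contradiction (subst (0# <_) square (*-pos 0<-1 0<-1)) (λ 0<1 → <-irrefl refl (<-trans 0<1 1<0))
    where
    0<-1 : 0# < - 1#
    0<-1 = subst (_< - 1#) (-‿inverseʳ 1#) (subst (1# + - 1# <_) (+-identityˡ _) (+-mono-< (- 1#) 1<0))
    square : - 1# * - 1# ≡ 1#
    square = trans (-1*x≈-x (- 1#)) (-‿involutive 1#)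

  NonNegative : Carrier → Set
  NonNegative x = x ≡ 0# ⊎ 0# < x

  pos+nonNeg : ∀ {x y} → 0# < x → NonNegative y → 0# < x + y
  pos+nonNeg {x} 0<x (inj₁ refl) = subst (0# <_) (sym (+-identityʳ x)) 0<x
  pos+nonNeg {x} {y} 0<x (inj₂ 0<y) =
    <-trans 0<y (subst (_< x + y) (+-identityˡ y) (+-mono-< y 0<x))

  nonNeg+nonNeg : ∀ {x y} → NonNegative x → NonNegative y → NonNegative (x + y)
  nonNeg+nonNeg {y = y} (inj₁ refl) py = subst NonNegative (sym (+-identityˡ y)) py
  nonNeg+nonNeg         (inj₂ 0<x)  py = inj₂ (pos+nonNeg 0<x py)

  pos⇒≢0 : ∀ {x} → 0# < x → x ≢ 0#
  pos⇒≢0 0<x refl = <-irrefl refl 0<x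

  1+1≢0 : 1# + 1# ≢ 0#
  1+1≢0 = pos⇒≢0 (pos+nonNeg 0<1 (inj₂ 0<1))

  *-cancelˡ : ∀ x {y z} → x ≢ 0# → x * y ≡ x * z → y ≡ z
  *-cancelˡ x {y} {z} x≢0 eq = begin
    y                 ≡⟨ undo y ⟨
    x ⁻¹ * (x * y)    ≡⟨ cong (x ⁻¹ *_) eq ⟩
    x ⁻¹ * (x * z)    ≡⟨ undo z ⟩
    z                 ∎
    where
    open ≡-Reasoning
    undo : ∀ w → x ⁻¹ * (x * w) ≡ w
    undo w = begin
      x ⁻¹ * (x * w)  ≡⟨ *-assoc _ _ _ ⟨
      x ⁻¹ * x * w    ≡⟨ cong (_* w) (trans (*-comm _ _) (⁻¹-inverse x x≢0)) ⟩
      1# * w          ≡⟨ *-identityˡ w ⟩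
      w               ∎

  *⁻¹-solve : ∀ {x y z} → y ≢ 0# → x * y ⁻¹ ≡ z → z * y ≡ x
  *⁻¹-solve {x} {y} y≢0 refl = begin
    x * y ⁻¹ * y    ≡⟨ *-assoc _ _ _ ⟩
    x * (y ⁻¹ * y)  ≡⟨ cong (x *_) (trans (*-comm _ _) (⁻¹-inverse y y≢0)) ⟩
    x * 1#          ≡⟨ *-identityʳ x ⟩
    x               ∎
    where open ≡-Reasoning

  fromℕ-+ : ∀ i j → fromℕ (i ℕ.+ j) ≡ fromℕ i + fromℕ j
  fromℕ-+ zero    j = sym (+-identityˡ _)
  fromℕ-+ (suc i) j = trans (cong (1# +_) (fromℕ-+ i j)) (sym (+-assoc _ _ _))

  fromℕ-2^suc : ∀ i → fromℕ (2 ^ suc i) ≡ fromℕ (2 ^ i) + fromℕ (2 ^ i)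
  fromℕ-2^suc i = trans (fromℕ-+ (2 ^ i) _) (cong (λ m → fromℕ (2 ^ i) + fromℕ m) (ℕₚ.+-identityʳ (2 ^ i)))

  Bit : Carrier → Set
  Bit x = x ≡ 0# ⊎ x ≡ 1#

  bit-nonNeg : ∀ {x} → Bit x → NonNegative x
  bit-nonNeg (inj₁ eq)   = inj₁ eq
  bit-nonNeg (inj₂ refl) = inj₂ 0<1

  bit? : ∀ x → Bit x ⊎ ¬ Bit x
  bit? x with x ≟ 0# | x ≟ 1#
  ... | yes eq | _      = inj₁ (inj₁ eq)
  ... | no  _  | yes eq = inj₁ (inj₂ eq)
  ... | no  p  | no  q  = inj₂ λ { (inj₁ eq) → p eq ; (inj₂ eq) → q eq }

  bit+1 : ∀ {x y} → Bit x → y ≡ 1# → Bit (x + y) → x ≡ 0#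
  bit+1 (inj₁ eq)   _    _           = eq
  bit+1 (inj₂ refl) refl (inj₁ 2≡0)  = contradiction 2≡0 1+1≢0
  -- Here `x` is `1#`, so the absurd equation `1# ≡ 0#` is itself the goal.
  bit+1 (inj₂ refl) refl (inj₂ 2≡1)  = +-cancelˡ 1# _ _ (trans 2≡1 (sym (+-identityʳ 1#)))

  -- A difference of two bits is 0, 1 or -1, and it is -1 only as 0 - 1. This is how the value -1 of
  -- `fU24` arises.
  bit+nonbit : ∀ {x y} → Bit x → Bit (x + y) → ¬ Bit y → x ≡ 1# × y ≡ - 1#
  bit+nonbit {y = y} (inj₁ refl) by ¬y = contradiction (subst Bit (+-identityˡ y) by) ¬y
  bit+nonbit (inj₂ refl) (inj₁ eq) ¬y = refl , +-inverseʳ-unique 1# _ eq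
  bit+nonbit (inj₂ refl) (inj₂ eq) ¬y = contradiction (inj₁ (+-cancelˡ 1# _ _ (trans eq (sym (+-identityʳ 1#))))) ¬y

  -- Sums over subsets

  sum-cong : ∀ (Y : Subset n) {g h : Subset n → Carrier} → (∀ Z → g Z ≡ h Z) → sumSub ℝ Y g ≡ sumSub ℝ Y h
  sum-cong []          eq = eq []
  sum-cong (false ∷ Y) eq = sum-cong Y (eq ∘ (false ∷_))
  sum-cong (true  ∷ Y) eq = cong₂ _+_ (sum-cong Y (eq ∘ (false ∷_))) (sum-cong Y (eq ∘ (true ∷_)))

  sum-nonNeg : ∀ (Y : Subset n) {g : Subset n → Carrier} → (∀ Z → NonNegative (g Z)) → NonNegative (sumSub ℝ Y g)
  sum-nonNeg []          pos = pos []
  sum-nonNeg (false ∷ Y) pos = sum-nonNeg Y (pos ∘ (false ∷_))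
  sum-nonNeg (true  ∷ Y) pos = nonNeg+nonNeg (sum-nonNeg Y (pos ∘ (false ∷_))) (sum-nonNeg Y (pos ∘ (true ∷_)))

  sum-insert : ∀ (Y : Subset n) i (g : Subset n → Carrier) → i ∉ Y →
               sumSub ℝ (Y ∪ ⁅ i ⁆) g ≡ sumSub ℝ Y g + sumSub ℝ Y (λ Z → g (Z ∪ ⁅ i ⁆))
  sum-insert (true  ∷ Y) zero    g i∉ = contradiction here i∉
  sum-insert (false ∷ Y) zero    g i∉ rewrite ∪-identityʳ Y =
    cong (sumSub ℝ Y (g ∘ (false ∷_)) +_) (sum-cong Y λ Z → cong (g ∘ (true ∷_)) (sym (∪-identityʳ Z)))
  sum-insert (false ∷ Y) (suc i) g i∉ = sum-insert Y i (g ∘ (false ∷_)) (i∉ ∘ there)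
  sum-insert (true  ∷ Y) (suc i) g i∉ =
    trans (cong₂ _+_ (sum-insert Y i (g ∘ (false ∷_)) (i∉ ∘ there)) (sum-insert Y i (g ∘ (true ∷_)) (i∉ ∘ there)))
          (+-interchange _ _ _ _)

  sum-⊥ : ∀ {n} (g : Subset n → Carrier) → sumSub ℝ ⊥ g ≡ g ⊥
  sum-⊥ {zero}  g = refl
  sum-⊥ {suc n} g = sum-⊥ (g ∘ (false ∷_))

  -- Linearity on the subsets of a set

  -- Contraction only restricts the domain. Looking at the subsets of `A` therefore replaces
  -- contracting the rest, and the ground set stays fixed.
  LinearOn : (Subset n → Carrier) → Subset n → Set
  LinearOn h A = (∀ W → W ⊑ A → Bit (h W))
               × (∀ U V → U ⊑ A → V ⊑ A → h U ≡ 1# → h V ≡ 1# → h (U △ V) ≡ 1#)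

  linearOn-cong : ∀ {g h : Subset n → Carrier} {A} → (∀ W → g W ≡ h W) → LinearOn g A → LinearOn h A
  linearOn-cong eq (bit , closed) =
      (λ W W⊑A → subst Bit (eq W) (bit W W⊑A))
    , λ U V U⊑A V⊑A hU hV →
        trans (sym (eq (U △ V))) (closed U V U⊑A V⊑A (trans (eq U) hU) (trans (eq V) hV))

  linearOn⇒linear : ∀ {h : Subset n → Carrier} → LinearOn h ⊤ → Linear ℝ h
  linearOn⇒linear (bit , closed) =
      (λ W → bit W (∩-identityʳ W))
    , λ U V → closed U V (∩-identityʳ U) (∩-identityʳ V)

  record IsU24On (h : Subset n → Carrier) (A : Subset n) : Set where
    field
      φ          : Fin 4 → Fin n
      injective  : ∀ {i j} → φ i ≡ φ j → i ≡ j
      inside     : ∀ i → ⁅ φ i ⁆ ⊑ A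
      surjective : ∀ e → ⁅ e ⁆ ⊑ A → ∃ λ i → φ i ≡ e
      values     : ∀ W → fU24 ℝ W ≡ h (image φ W)

  -- The loopless inductive step: linear or isomorphic to `fU24`

  module Loopless
    (h : Subset n → Carrier) (A : Subset n)
    (h-⊥ : h ⊥ ≡ 1#)
    (h-atom : ∀ e → ⁅ e ⁆ ⊑ A → h ⁅ e ⁆ ≡ 0#)
    (contracted : ∀ e → ⁅ e ⁆ ⊑ A → LinearOn h (A ∖ ⁅ e ⁆))
    (deleted : ∀ e → ⁅ e ⁆ ⊑ A → LinearOn (λ W → h W + h (W ∪ ⁅ e ⁆)) (A ∖ ⁅ e ⁆))
    where

    -- The deletion of `e`. For `e` in `A` its denominator `h ⊥ + h ⁅ e ⁆` is 1, hence no division.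
    g : Fin n → Subset n → Carrier
    g e W = h W + h (W ∪ ⁅ e ⁆)

    bit-below : ∀ e W → ⁅ e ⁆ ⊑ A → ⁅ e ⁆ # W → W ⊑ A → Bit (h W)
    bit-below e W e⊑A e#W W⊑A = proj₁ (contracted e e⊑A) W
      (solve (⁅ e ⁆ ∷ W ∷ A ∷ []) (a ⋕ b ∷ b ≼ c ∷ []) (b ≼ c ∧ ~ a) (e#W ∷ W⊑A ∷ []))

    bit-deleted : ∀ e W → ⁅ e ⁆ ⊑ A → ⁅ e ⁆ # W → W ⊑ A → Bit (g e W)
    bit-deleted e W e⊑A e#W W⊑A = proj₁ (deleted e e⊑A) W
      (solve (⁅ e ⁆ ∷ W ∷ A ∷ []) (a ⋕ b ∷ b ≼ c ∷ []) (b ≼ c ∧ ~ a) (e#W ∷ W⊑A ∷ []))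

    module Closed (bit : ∀ W → W ⊑ A → Bit (h W)) where

      -- Suppose `h (U △ V)` is 0 and let `U′` be `U` without `e`. The deletion of `e` takes bit
      -- values, so `h U′` and `h (V ∪ ⁅ e ⁆)` vanish and the deletion is 1 at `U′` and at `V`. By
      -- its linearity it is 1 at `U′ △ V`, and the supposition puts that value on `h (U′ △ V)`.
      -- Linearity away from `e`, applied to `U′ △ V` and `V`, then makes `h U′` equal to 1.
      closed-at : ∀ e U V → ⁅ e ⁆ ⊑ U → ⁅ e ⁆ # V → U ⊑ A → V ⊑ A →
                  h U ≡ 1# → h V ≡ 1# → h (U △ V) ≡ 1#
      closed-at e U V e⊑U e#V U⊑A V⊑A hU hV with bit (U △ V) U△V⊑A
        where
        U△V⊑A : U △ V ⊑ A
        U△V⊑A = solve (U ∷ V ∷ A ∷ []) (a ≼ c ∷ b ≼ c ∷ []) (a ⊕ b ≼ c) (U⊑A ∷ V⊑A ∷ [])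
      ... | inj₂ h≡1 = h≡1
      ... | inj₁ h≡0 = contradiction (trans (sym h[U′]≡0) h[U′]≡1) 0≢1
        where
        U′ : Subset n
        U′ = U ∖ ⁅ e ⁆
        ρ : Vec (Subset n) 4
        ρ = ⁅ e ⁆ ∷ U ∷ V ∷ A ∷ []
        e⊑A : ⁅ e ⁆ ⊑ A
        e⊑A = solve ρ (a ≼ b ∷ b ≼ d ∷ []) (a ≼ d) (e⊑U ∷ U⊑A ∷ [])
        U′⊑ : U′ ⊑ A ∖ ⁅ e ⁆
        U′⊑ = solve ρ (b ≼ d ∷ []) (b ∧ ~ a ≼ d ∧ ~ a) (U⊑A ∷ [])
        V⊑ : V ⊑ A ∖ ⁅ e ⁆
        V⊑ = solve ρ (a ⋕ c ∷ c ≼ d ∷ []) (c ≼ d ∧ ~ a) (e#V ∷ V⊑A ∷ [])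
        h[U′∪e]≡1 : h (U′ ∪ ⁅ e ⁆) ≡ 1#
        h[U′∪e]≡1 = trans (cong h (solve ρ (a ≼ b ∷ []) ((b ∧ ~ a) ∨ a ≐ b) (e⊑U ∷ []))) hU
        h[U′]≡0 : h U′ ≡ 0#
        h[U′]≡0 = bit+1 (proj₁ (contracted e e⊑A) U′ U′⊑) h[U′∪e]≡1 (proj₁ (deleted e e⊑A) U′ U′⊑)
        g[U′]≡1 : g e U′ ≡ 1#
        g[U′]≡1 = trans (cong₂ _+_ h[U′]≡0 h[U′∪e]≡1) (+-identityˡ 1#)
        h[V∪e]≡0 : h (V ∪ ⁅ e ⁆) ≡ 0#
        h[V∪e]≡0 = bit+1 (bit (V ∪ ⁅ e ⁆) (solve ρ (a ≼ d ∷ c ≼ d ∷ []) (c ∨ a ≼ d) (e⊑A ∷ V⊑A ∷ [])))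
          hV (subst Bit (+-comm _ _) (proj₁ (deleted e e⊑A) V V⊑))
        g[V]≡1 : g e V ≡ 1#
        g[V]≡1 = trans (cong₂ _+_ hV h[V∪e]≡0) (+-identityʳ 1#)
        g[U′△V]≡1 : g e (U′ △ V) ≡ 1#
        g[U′△V]≡1 = proj₂ (deleted e e⊑A) U′ V U′⊑ V⊑ g[U′]≡1 g[V]≡1
        h[U′△V∪e]≡0 : h ((U′ △ V) ∪ ⁅ e ⁆) ≡ 0#
        h[U′△V∪e]≡0 = trans (cong h (solve ρ (a ≼ b ∷ a ⋕ c ∷ []) (((b ∧ ~ a) ⊕ c) ∨ a ≐ b ⊕ c) (e⊑U ∷ e#V ∷ []))) h≡0
        h[U′△V]≡1 : h (U′ △ V) ≡ 1#
        h[U′△V]≡1 = trans (sym (+-identityʳ _)) (trans (cong (h (U′ △ V) +_) (sym h[U′△V∪e]≡0)) g[U′△V]≡1)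
        h[U′]≡1 : h U′ ≡ 1#
        h[U′]≡1 = trans (cong h (solve ρ [] (b ∧ ~ a ≐ ((b ∧ ~ a) ⊕ c) ⊕ c) []))
          (proj₂ (contracted e e⊑A) (U′ △ V) V
            (solve ρ (b ≼ d ∷ a ⋕ c ∷ c ≼ d ∷ []) ((b ∧ ~ a) ⊕ c ≼ d ∧ ~ a) (U⊑A ∷ e#V ∷ V⊑A ∷ []))
            V⊑ h[U′△V]≡1 hV)

      -- An element of `U △ V` lies in exactly one of the two sets, and `△` is commutative, so
      -- `closed-at` applies.
      closed : ∀ U V → U ⊑ A → V ⊑ A → h U ≡ 1# → h V ≡ 1# → h (U △ V) ≡ 1#
      closed U V U⊑A V⊑A hU hV with inhabited? (U △ V)
      ... | inj₁ empty = trans (cong h empty) h-⊥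
      ... | inj₂ (e , e⊑) with atom? e U
      ... | inj₁ e⊑U = closed-at e U V e⊑U
              (solve (⁅ e ⁆ ∷ U ∷ V ∷ []) (a ≼ b ∷ a ≼ b ⊕ c ∷ []) (a ⋕ c) (e⊑U ∷ e⊑ ∷ [])) U⊑A V⊑A hU hV
      ... | inj₂ e#U = trans (cong h (solve (U ∷ V ∷ []) [] (a ⊕ b ≐ b ⊕ a) []))
              (closed-at e V U (solve (⁅ e ⁆ ∷ U ∷ V ∷ []) (a ⋕ b ∷ a ≼ b ⊕ c ∷ []) (a ≼ c) (e#U ∷ e⊑ ∷ []))
                e#U V⊑A U⊑A hV hU)

    -- The critical case, in which `h A` is -1

    module Critical (h-A : h A ≡ - 1#) (h-coatom : ∀ e → ⁅ e ⁆ ⊑ A → h (A ∖ ⁅ e ⁆) ≡ 1#) where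

      -- Putting `x` back yields the coatom `A ∖ ⁅ y ⁆`, of value 1. Since the deletion takes bit
      -- values, its other summand is 0.
      deleted-coatom : ∀ x y → ⁅ x ⁆ ⊑ A → ⁅ y ⁆ ⊑ A → ⁅ x ⁆ # ⁅ y ⁆ → g x (A ∖ ⁅ x ⁆ ∖ ⁅ y ⁆) ≡ 1#
      deleted-coatom x y x⊑A y⊑A x#y = trans (cong₂ _+_ h≡0 h≡1) (+-identityˡ 1#)
        where
        W : Subset n
        W = A ∖ ⁅ x ⁆ ∖ ⁅ y ⁆
        ρ : Vec (Subset n) 3
        ρ = ⁅ x ⁆ ∷ ⁅ y ⁆ ∷ A ∷ []
        x#W : ⁅ x ⁆ # W
        x#W = solve ρ [] (a ⋕ c ∧ ~ a ∧ ~ b) []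
        W⊑A : W ⊑ A
        W⊑A = solve ρ [] (c ∧ ~ a ∧ ~ b ≼ c) []
        h≡1 : h (W ∪ ⁅ x ⁆) ≡ 1#
        h≡1 = trans (cong h (solve ρ (a ≼ c ∷ a ⋕ b ∷ []) ((c ∧ ~ a ∧ ~ b) ∨ a ≐ c ∧ ~ b) (x⊑A ∷ x#y ∷ [])))
                    (h-coatom y y⊑A)
        h≡0 : h W ≡ 0#
        h≡0 = bit+1 (bit-below x W x⊑A x#W W⊑A) h≡1 (bit-deleted x W x⊑A x#W W⊑A)

      -- If the pair had value 1, the deletion of `x` would be 1 at `⁅ y ⁆` as well as at
      -- `A ∖ ⁅ x ⁆ ∖ ⁅ y ⁆`, hence 1 at their symmetric difference `A ∖ ⁅ x ⁆`. There, however, it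
      -- is 1 - 1.
      h-pair : ∀ x y → ⁅ x ⁆ ⊑ A → ⁅ y ⁆ ⊑ A → ⁅ x ⁆ # ⁅ y ⁆ → h (⁅ x ⁆ ∪ ⁅ y ⁆) ≡ 0#
      h-pair x y x⊑A y⊑A x#y with inhabited? (A ∖ (⁅ x ⁆ ∪ ⁅ y ⁆))
      -- When `x` and `y` exhaust `A`, the singleton `⁅ y ⁆` is both an atom, of value 0, and a
      -- coatom, of value 1.
      ... | inj₁ empty = contradiction (trans (sym (h-atom y y⊑A)) h[y]≡1) 0≢1
        where
        h[y]≡1 : h ⁅ y ⁆ ≡ 1#
        h[y]≡1 = trans (cong h (solve (⁅ x ⁆ ∷ ⁅ y ⁆ ∷ A ∷ [])
            (a ⋕ b ∷ b ≼ c ∷ c ∧ ~ (a ∨ b) ≐ ∅ ∷ []) (b ≐ c ∧ ~ a) (x#y ∷ y⊑A ∷ empty ∷ [])))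
          (h-coatom x x⊑A)
      -- A third element `z` outside the pair ensures that the value on the pair is a bit.
      ... | inj₂ (z , z⊑) with bit-below z (⁅ x ⁆ ∪ ⁅ y ⁆)
                (solve (⁅ x ⁆ ∷ ⁅ y ⁆ ∷ ⁅ z ⁆ ∷ A ∷ []) (c ≼ d ∧ ~ (a ∨ b) ∷ []) (c ≼ d) (z⊑ ∷ []))
                (solve (⁅ x ⁆ ∷ ⁅ y ⁆ ∷ ⁅ z ⁆ ∷ A ∷ []) (c ≼ d ∧ ~ (a ∨ b) ∷ []) (c ⋕ a ∨ b) (z⊑ ∷ []))
                (solve (⁅ x ⁆ ∷ ⁅ y ⁆ ∷ A ∷ []) (a ≼ c ∷ b ≼ c ∷ []) (a ∨ b ≼ c) (x⊑A ∷ y⊑A ∷ []))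
      ...   | inj₁ h≡0 = h≡0
      ...   | inj₂ h≡1 = contradiction (trans (sym g≡0) g≡1) 0≢1
        where
        ρ : Vec (Subset n) 3
        ρ = ⁅ x ⁆ ∷ ⁅ y ⁆ ∷ A ∷ []
        g[y]≡1 : g x ⁅ y ⁆ ≡ 1#
        g[y]≡1 = trans (cong₂ _+_ (h-atom y y⊑A) (trans (cong h (solve ρ [] (b ∨ a ≐ a ∨ b) [])) h≡1)) (+-identityˡ 1#)
        g≡1 : g x (A ∖ ⁅ x ⁆) ≡ 1#
        g≡1 = trans (cong (g x) (solve ρ (b ≼ c ∷ a ⋕ b ∷ []) (c ∧ ~ a ≐ (c ∧ ~ a ∧ ~ b) ⊕ b) (y⊑A ∷ x#y ∷ [])))
          (proj₂ (deleted x x⊑A) (A ∖ ⁅ x ⁆ ∖ ⁅ y ⁆) ⁅ y ⁆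
            (solve ρ [] (c ∧ ~ a ∧ ~ b ≼ c ∧ ~ a) [])
            (solve ρ (b ≼ c ∷ a ⋕ b ∷ []) (b ≼ c ∧ ~ a) (y⊑A ∷ x#y ∷ []))
            (deleted-coatom x y x⊑A y⊑A x#y) g[y]≡1)
        g≡0 : g x (A ∖ ⁅ x ⁆) ≡ 0#
        g≡0 = trans (cong₂ _+_ (h-coatom x x⊑A)
            (trans (cong h (solve ρ (a ≼ c ∷ []) ((c ∧ ~ a) ∨ a ≐ c) (x⊑A ∷ []))) h-A))
          (-‿inverseʳ 1#)

      -- After deleting `x`, the pair of `y` and `z` is the symmetric difference of two sets of
      -- value 1 by `deleted-coatom`. The summand without `x` vanishes by `h-pair`, which leaves the
      -- value on the triple.
      h-triple : ∀ x y z → ⁅ x ⁆ ⊑ A → ⁅ y ⁆ ⊑ A → ⁅ z ⁆ ⊑ A →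
                 ⁅ x ⁆ # ⁅ y ⁆ → ⁅ x ⁆ # ⁅ z ⁆ → ⁅ y ⁆ # ⁅ z ⁆ → h (⁅ x ⁆ ∪ ⁅ y ⁆ ∪ ⁅ z ⁆) ≡ 1#
      h-triple x y z x⊑A y⊑A z⊑A x#y x#z y#z = begin
        h (⁅ x ⁆ ∪ ⁅ y ⁆ ∪ ⁅ z ⁆)    ≡⟨ cong h (solve ρ [] (a ∨ (b ∨ c) ≐ (b ∨ c) ∨ a) []) ⟩
        h ((⁅ y ⁆ ∪ ⁅ z ⁆) ∪ ⁅ x ⁆)  ≡⟨ +-identityˡ _ ⟨
        0# + h ((⁅ y ⁆ ∪ ⁅ z ⁆) ∪ ⁅ x ⁆)  ≡⟨ cong (_+ h ((⁅ y ⁆ ∪ ⁅ z ⁆) ∪ ⁅ x ⁆)) (h-pair y z y⊑A z⊑A y#z) ⟨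
        g x (⁅ y ⁆ ∪ ⁅ z ⁆)          ≡⟨ cong (g x) (solve ρ (b ≼ d ∷ c ≼ d ∷ a ⋕ b ∷ a ⋕ c ∷ b ⋕ c ∷ [])
                                          (b ∨ c ≐ (d ∧ ~ a ∧ ~ b) ⊕ (d ∧ ~ a ∧ ~ c))
                                          (y⊑A ∷ z⊑A ∷ x#y ∷ x#z ∷ y#z ∷ [])) ⟩
        g x ((A ∖ ⁅ x ⁆ ∖ ⁅ y ⁆) △ (A ∖ ⁅ x ⁆ ∖ ⁅ z ⁆))
                                     ≡⟨ proj₂ (deleted x x⊑A) _ _
                                          (solve ρ [] (d ∧ ~ a ∧ ~ b ≼ d ∧ ~ a) [])
                                          (solve ρ [] (d ∧ ~ a ∧ ~ c ≼ d ∧ ~ a) [])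
                                          (deleted-coatom x y x⊑A y⊑A x#y) (deleted-coatom x z x⊑A z⊑A x#z) ⟩
        1#                           ∎
        where
        open ≡-Reasoning
        ρ : Vec (Subset n) 4
        ρ = ⁅ x ⁆ ∷ ⁅ y ⁆ ∷ ⁅ z ⁆ ∷ A ∷ []

      -1≢0 : - 1# ≢ 0#
      -1≢0 eq = 0≢1 (sym (trans (sym (+-identityʳ 1#)) (trans (cong (1# +_) (sym eq)) (-‿inverseʳ 1#))))

      -1≢1 : - 1# ≢ 1#
      -1≢1 eq = 1+1≢0 (trans (cong (1# +_) (sym eq)) (-‿inverseʳ 1#))

      -- Elements of `A` are picked one by one. Stopping before the fourth would make `A` empty, an
      -- atom, a pair or a triple, whose values 1, 0, 0, 1 all differ from -1.
      isU24 : IsU24On h A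
      isU24 with inhabited? A
      ... | inj₁ A≡⊥ = contradiction (trans (sym h-A) (trans (cong h A≡⊥) h-⊥)) -1≢1
      ... | inj₂ (x , x⊑A) with inhabited? (A ∖ ⁅ x ⁆)
      ... | inj₁ rest = contradiction
              (trans (sym h-A) (trans (cong h (solve (⁅ x ⁆ ∷ A ∷ []) (a ≼ b ∷ b ∧ ~ a ≐ ∅ ∷ []) (b ≐ a) (x⊑A ∷ rest ∷ [])))
                (h-atom x x⊑A))) -1≢0
      ... | inj₂ (y , y⊑) with inhabited? (A ∖ (⁅ x ⁆ ∪ ⁅ y ⁆))
                             | solve (⁅ x ⁆ ∷ ⁅ y ⁆ ∷ A ∷ []) (b ≼ c ∧ ~ a ∷ []) (b ≼ c) (y⊑ ∷ [])
                             | solve (⁅ x ⁆ ∷ ⁅ y ⁆ ∷ A ∷ []) (b ≼ c ∧ ~ a ∷ []) (a ⋕ b) (y⊑ ∷ [])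
      ... | inj₁ rest | y⊑A | x#y = contradiction
              (trans (sym h-A) (trans (cong h (solve (⁅ x ⁆ ∷ ⁅ y ⁆ ∷ A ∷ [])
                  (a ≼ c ∷ b ≼ c ∷ c ∧ ~ (a ∨ b) ≐ ∅ ∷ []) (c ≐ a ∨ b) (x⊑A ∷ y⊑A ∷ rest ∷ [])))
                (h-pair x y x⊑A y⊑A x#y))) -1≢0
      ... | inj₂ (z , z⊑) | y⊑A | x#y with inhabited? (A ∖ (⁅ x ⁆ ∪ ⁅ y ⁆ ∪ ⁅ z ⁆))
                             | solve (⁅ x ⁆ ∷ ⁅ y ⁆ ∷ ⁅ z ⁆ ∷ A ∷ []) (c ≼ d ∧ ~ (a ∨ b) ∷ []) (c ≼ d) (z⊑ ∷ [])
                             | solve (⁅ x ⁆ ∷ ⁅ y ⁆ ∷ ⁅ z ⁆ ∷ A ∷ []) (c ≼ d ∧ ~ (a ∨ b) ∷ []) (a ⋕ c) (z⊑ ∷ [])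
                             | solve (⁅ x ⁆ ∷ ⁅ y ⁆ ∷ ⁅ z ⁆ ∷ A ∷ []) (c ≼ d ∧ ~ (a ∨ b) ∷ []) (b ⋕ c) (z⊑ ∷ [])
      ... | inj₁ rest | z⊑A | x#z | y#z = contradiction
              (trans (sym h-A) (trans (cong h (solve (⁅ x ⁆ ∷ ⁅ y ⁆ ∷ ⁅ z ⁆ ∷ A ∷ [])
                  (a ≼ d ∷ b ≼ d ∷ c ≼ d ∷ d ∧ ~ (a ∨ (b ∨ c)) ≐ ∅ ∷ []) (d ≐ a ∨ (b ∨ c)) (x⊑A ∷ y⊑A ∷ z⊑A ∷ rest ∷ [])))
                (h-triple x y z x⊑A y⊑A z⊑A x#y x#z y#z))) -1≢1
      ... | inj₂ (w , w⊑) | z⊑A | x#z | y#z = record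
        { φ = φ
        ; injective = λ {i} {j} → φ-injective i j
        ; inside = φ-inside
        ; surjective = φ-surjective
        ; values = φ-values
        }
        where
        ρ : Vec (Subset n) 4
        ρ = ⁅ x ⁆ ∷ ⁅ y ⁆ ∷ ⁅ z ⁆ ∷ ⁅ w ⁆ ∷ []
        ρA : Vec (Subset n) 5
        ρA = ⁅ x ⁆ ∷ ⁅ y ⁆ ∷ ⁅ z ⁆ ∷ ⁅ w ⁆ ∷ A ∷ []
        w⊑A : ⁅ w ⁆ ⊑ A
        w⊑A = solve ρA (d ≼ e′ ∧ ~ (a ∨ (b ∨ c)) ∷ []) (d ≼ e′) (w⊑ ∷ [])
        x#w : ⁅ x ⁆ # ⁅ w ⁆
        x#w = solve ρA (d ≼ e′ ∧ ~ (a ∨ (b ∨ c)) ∷ []) (a ⋕ d) (w⊑ ∷ [])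
        y#w : ⁅ y ⁆ # ⁅ w ⁆
        y#w = solve ρA (d ≼ e′ ∧ ~ (a ∨ (b ∨ c)) ∷ []) (b ⋕ d) (w⊑ ∷ [])
        z#w : ⁅ z ⁆ # ⁅ w ⁆
        z#w = solve ρA (d ≼ e′ ∧ ~ (a ∨ (b ∨ c)) ∷ []) (c ⋕ d) (w⊑ ∷ [])

        -- A fifth element v would make h linear on A ∖ v, where the triples xyz
        -- and xyw have the pair zw as symmetric difference.
        A⊑xyzw : A ∖ (⁅ x ⁆ ∪ (⁅ y ⁆ ∪ (⁅ z ⁆ ∪ ⁅ w ⁆))) ≡ ⊥
        A⊑xyzw with inhabited? (A ∖ (⁅ x ⁆ ∪ (⁅ y ⁆ ∪ (⁅ z ⁆ ∪ ⁅ w ⁆))))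
        ... | inj₁ empty = empty
        ... | inj₂ (v , v⊑) = contradiction (trans (sym (h-pair z w z⊑A w⊑A z#w)) h[zw]≡1) 0≢1
          where
          ρᵥ : Vec (Subset n) 6
          ρᵥ = ⁅ x ⁆ ∷ ⁅ y ⁆ ∷ ⁅ z ⁆ ∷ ⁅ w ⁆ ∷ A ∷ ⁅ v ⁆ ∷ []
          outside : Equation 6
          outside = var 5F ≼ e′ ∧ ~ (a ∨ (b ∨ (c ∨ d)))
          h[zw]≡1 : h (⁅ z ⁆ ∪ ⁅ w ⁆) ≡ 1#
          h[zw]≡1 = trans
            (cong h (solve ρ (a ⋕ c ∷ a ⋕ d ∷ b ⋕ c ∷ b ⋕ d ∷ c ⋕ d ∷ [])
              (c ∨ d ≐ (a ∨ (b ∨ c)) ⊕ (a ∨ (b ∨ d))) (x#z ∷ x#w ∷ y#z ∷ y#w ∷ z#w ∷ [])))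
            (proj₂ (contracted v (solve ρᵥ (outside ∷ []) (var 5F ≼ e′) (v⊑ ∷ []))) _ _
              (solve ρᵥ (outside ∷ a ≼ e′ ∷ b ≼ e′ ∷ c ≼ e′ ∷ []) (a ∨ (b ∨ c) ≼ e′ ∧ ~ (var 5F)) (v⊑ ∷ x⊑A ∷ y⊑A ∷ z⊑A ∷ []))
              (solve ρᵥ (outside ∷ a ≼ e′ ∷ b ≼ e′ ∷ d ≼ e′ ∷ []) (a ∨ (b ∨ d) ≼ e′ ∧ ~ (var 5F)) (v⊑ ∷ x⊑A ∷ y⊑A ∷ w⊑A ∷ []))
              (h-triple x y z x⊑A y⊑A z⊑A x#y x#z y#z)
              (h-triple x y w x⊑A y⊑A w⊑A x#y x#w y#w))

        φ : Fin 4 → Fin n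
        φ = lookup (x ∷ y ∷ z ∷ w ∷ [])

        φ-injective : ∀ i j → φ i ≡ φ j → i ≡ j
        φ-injective 0F 0F _  = refl
        φ-injective 0F 1F eq = contradiction eq (#⇒≢ x#y)
        φ-injective 0F 2F eq = contradiction eq (#⇒≢ x#z)
        φ-injective 0F 3F eq = contradiction eq (#⇒≢ x#w)
        φ-injective 1F 0F eq = contradiction (sym eq) (#⇒≢ x#y)
        φ-injective 1F 1F _  = refl
        φ-injective 1F 2F eq = contradiction eq (#⇒≢ y#z)
        φ-injective 1F 3F eq = contradiction eq (#⇒≢ y#w)
        φ-injective 2F 0F eq = contradiction (sym eq) (#⇒≢ x#z)
        φ-injective 2F 1F eq = contradiction (sym eq) (#⇒≢ y#z)
        φ-injective 2F 2F _  = refl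
        φ-injective 2F 3F eq = contradiction eq (#⇒≢ z#w)
        φ-injective 3F 0F eq = contradiction (sym eq) (#⇒≢ x#w)
        φ-injective 3F 1F eq = contradiction (sym eq) (#⇒≢ y#w)
        φ-injective 3F 2F eq = contradiction (sym eq) (#⇒≢ z#w)
        φ-injective 3F 3F _  = refl

        φ-inside : ∀ i → ⁅ φ i ⁆ ⊑ A
        φ-inside 0F = x⊑A
        φ-inside 1F = y⊑A
        φ-inside 2F = z⊑A
        φ-inside 3F = w⊑A

        φ-surjective : ∀ e → ⁅ e ⁆ ⊑ A → ∃ λ i → φ i ≡ e
        φ-surjective e e⊑A with x Fin.≟ e | y Fin.≟ e | z Fin.≟ e | w Fin.≟ e
        ... | yes x≡e | _ | _ | _ = 0F , x≡e
        ... | no _ | yes y≡e | _ | _ = 1F , y≡e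
        ... | no _ | no _ | yes z≡e | _ = 2F , z≡e
        ... | no _ | no _ | no _ | yes w≡e = 3F , w≡e
        ... | no x≢e | no y≢e | no z≢e | no w≢e = contradiction (x∈⁅x⁆ e) (subst (e ∉_) (sym e≡⊥) ∉⊥)
          where
          e≡⊥ : ⁅ e ⁆ ≡ ⊥
          e≡⊥ = solve (⁅ x ⁆ ∷ ⁅ y ⁆ ∷ ⁅ z ⁆ ∷ ⁅ w ⁆ ∷ A ∷ ⁅ e ⁆ ∷ [])
            (var 5F ≼ e′ ∷ e′ ∧ ~ (a ∨ (b ∨ (c ∨ d))) ≐ ∅ ∷ a ⋕ var 5F ∷ b ⋕ var 5F ∷ c ⋕ var 5F ∷ d ⋕ var 5F ∷ [])
            (var 5F ≐ ∅)
            (e⊑A ∷ A⊑xyzw ∷ ≢⇒# x≢e ∷ ≢⇒# y≢e ∷ ≢⇒# z≢e ∷ ≢⇒# w≢e ∷ [])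

        choose : Bool → Expr 4 → Expr 4
        choose false _ = ∅
        choose true  s = s

        -- This follows the recursion of `image`, final empty set included, so that for each
        -- concrete `W` its interpretation in `ρ` is `image φ W` by computation.
        imageᵉ : Subset 4 → Expr 4
        imageᵉ (p ∷ q ∷ s ∷ t ∷ []) = choose p a ∨ (choose q b ∨ (choose s c ∨ (choose t d ∨ ∅)))

        h-image : ∀ W t {v} {_ : T (everywhere 4 (impliesᵇ [] (imageᵉ W ≐ t)))} → h (⟦ t ⟧ ρ) ≡ v → v ≡ h (⟦ imageᵉ W ⟧ ρ)
        h-image W t {_} {valid} eq = trans (sym eq) (cong h (sym (solve ρ [] (imageᵉ W ≐ t) {valid} [])))

        φ-values : ∀ W → fU24 ℝ W ≡ h (image φ W)
        φ-values W@(false ∷ false ∷ false ∷ false ∷ []) = h-image W ∅ h-⊥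
        φ-values W@(true  ∷ false ∷ false ∷ false ∷ []) = h-image W a (h-atom x x⊑A)
        φ-values W@(false ∷ true  ∷ false ∷ false ∷ []) = h-image W b (h-atom y y⊑A)
        φ-values W@(false ∷ false ∷ true  ∷ false ∷ []) = h-image W c (h-atom z z⊑A)
        φ-values W@(false ∷ false ∷ false ∷ true  ∷ []) = h-image W d (h-atom w w⊑A)
        φ-values W@(true  ∷ true  ∷ false ∷ false ∷ []) = h-image W (a ∨ b) (h-pair x y x⊑A y⊑A x#y)
        φ-values W@(true  ∷ false ∷ true  ∷ false ∷ []) = h-image W (a ∨ c) (h-pair x z x⊑A z⊑A x#z)
        φ-values W@(true  ∷ false ∷ false ∷ true  ∷ []) = h-image W (a ∨ d) (h-pair x w x⊑A w⊑A x#w)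
        φ-values W@(false ∷ true  ∷ true  ∷ false ∷ []) = h-image W (b ∨ c) (h-pair y z y⊑A z⊑A y#z)
        φ-values W@(false ∷ true  ∷ false ∷ true  ∷ []) = h-image W (b ∨ d) (h-pair y w y⊑A w⊑A y#w)
        φ-values W@(false ∷ false ∷ true  ∷ true  ∷ []) = h-image W (c ∨ d) (h-pair z w z⊑A w⊑A z#w)
        φ-values W@(true  ∷ true  ∷ true  ∷ false ∷ []) = h-image W (a ∨ (b ∨ c)) (h-triple x y z x⊑A y⊑A z⊑A x#y x#z y#z)
        φ-values W@(true  ∷ true  ∷ false ∷ true  ∷ []) = h-image W (a ∨ (b ∨ d)) (h-triple x y w x⊑A y⊑A w⊑A x#y x#w y#w)
        φ-values W@(true  ∷ false ∷ true  ∷ true  ∷ []) = h-image W (a ∨ (c ∨ d)) (h-triple x z w x⊑A z⊑A w⊑A x#z x#w z#w)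
        φ-values W@(false ∷ true  ∷ true  ∷ true  ∷ []) = h-image W (b ∨ (c ∨ d)) (h-triple y z w y⊑A z⊑A w⊑A y#z y#w z#w)
        φ-values W@(true  ∷ true  ∷ true  ∷ true  ∷ []) = h-image W (a ∨ (b ∨ (c ∨ d)))
          (trans (cong h (solve ρA (a ≼ e′ ∷ b ≼ e′ ∷ c ≼ e′ ∷ d ≼ e′ ∷ e′ ∧ ~ (a ∨ (b ∨ (c ∨ d))) ≐ ∅ ∷ [])
            (a ∨ (b ∨ (c ∨ d)) ≐ e′) (x⊑A ∷ y⊑A ∷ z⊑A ∷ w⊑A ∷ A⊑xyzw ∷ []))) h-A)

    -- A proper subset of `A` misses some element, so its value is a bit and only `h A` is in doubt.
    -- If `h A` is no bit, then deleting any `e` forces value 1 on `A ∖ ⁅ e ⁆` and -1 on `A`.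
    linear-or-U24 : LinearOn h A ⊎ IsU24On h A
    linear-or-U24 with inhabited? A | bit? (h A)
    ... | inj₁ A≡⊥ | inj₂ ¬bit = contradiction (inj₂ (trans (cong h A≡⊥) h-⊥)) ¬bit
    ... | _ | inj₁ bit-A = inj₁ (bit , Closed.closed bit)
      where
      bit : ∀ W → W ⊑ A → Bit (h W)
      bit W W⊑A with inhabited? (A ∖ W)
      ... | inj₁ empty = subst (Bit ∘ h) (solve (W ∷ A ∷ []) (a ≼ b ∷ b ∧ ~ a ≐ ∅ ∷ []) (b ≐ a) (W⊑A ∷ empty ∷ [])) bit-A
      ... | inj₂ (e , e⊑) = bit-below e W
              (solve (⁅ e ⁆ ∷ W ∷ A ∷ []) (a ≼ c ∧ ~ b ∷ []) (a ≼ c) (e⊑ ∷ []))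
              (solve (⁅ e ⁆ ∷ W ∷ A ∷ []) (a ≼ c ∧ ~ b ∷ []) (a ⋕ b) (e⊑ ∷ [])) W⊑A
    ... | inj₂ (e₀ , e₀⊑A) | inj₂ ¬bit =
      inj₂ (Critical.isU24 (proj₂ (top e₀ e₀⊑A)) (λ e e⊑A → proj₁ (top e e⊑A)))
      where
      top : ∀ e → ⁅ e ⁆ ⊑ A → h (A ∖ ⁅ e ⁆) ≡ 1# × h A ≡ - 1#
      top e e⊑A = bit+nonbit (bit-below e (A ∖ ⁅ e ⁆) e⊑A e#A′ A′⊑A)
        (subst (λ X → Bit (h (A ∖ ⁅ e ⁆) + h X)) (solve ρ (a ≼ b ∷ []) ((b ∧ ~ a) ∨ a ≐ b) (e⊑A ∷ []))
          (bit-deleted e (A ∖ ⁅ e ⁆) e⊑A e#A′ A′⊑A)) ¬bit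
        where
        ρ : Vec (Subset n) 2
        ρ = ⁅ e ⁆ ∷ A ∷ []
        e#A′ : ⁅ e ⁆ # A ∖ ⁅ e ⁆
        e#A′ = solve ρ [] (a ⋕ b ∧ ~ a) []
        A′⊑A : A ∖ ⁅ e ⁆ ⊑ A
        A′⊑A = solve ρ [] (b ∧ ~ a ≼ b) []

  -- Matroidal functions

  module MatroidalFunction
    (f : Subset n → Carrier) (f-⊥ : f ⊥ ≡ 1#) (r : Subset n → ℕ)
    (rankable : ∀ X → sumSub ℝ (compl ℝ X) f ≢ 0# ×
                      sumSub ℝ (full ℝ) f * sumSub ℝ (compl ℝ X) f ⁻¹ ≡ fromℕ (2 ^ r X))
    (matroid : IsMatroidRank ℝ r)
    where

    r-size : ∀ X → r X ℕ.≤ ∣ X ∣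
    r-size = proj₁ matroid

    r-mono : ∀ X e → e ∉ X → r X ℕ.≤ r (X ∪ ⁅ e ⁆)
    r-mono = proj₁ (proj₂ matroid)

    r-submodular : ∀ X x y → x ∉ X → y ∉ X → x ≢ y →
                   r X ℕ.+ r (X ∪ ⁅ x ⁆ ∪ ⁅ y ⁆) ℕ.≤ r (X ∪ ⁅ x ⁆) ℕ.+ r (X ∪ ⁅ y ⁆)
    r-submodular = proj₂ (proj₂ matroid)

    -- A singleton has rank at most 1, and by submodularity the increment due to `e` does not grow
    -- with `X`.
    r-unit : ∀ e X → e ∉ X → r (X ∪ ⁅ e ⁆) ℕ.≤ suc (r X)
    r-unit e = subset-induction (λ X → e ∉ X → r (X ∪ ⁅ e ⁆) ℕ.≤ suc (r X)) base step
      where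
      open ℕₚ.≤-Reasoning
      base : e ∉ ⊥ → r (⊥ ∪ ⁅ e ⁆) ℕ.≤ suc (r ⊥)
      base _ = begin
        r (⊥ ∪ ⁅ e ⁆)  ≡⟨ cong r (∪-identityˡ ⁅ e ⁆) ⟩
        r ⁅ e ⁆        ≤⟨ r-size ⁅ e ⁆ ⟩
        ∣ ⁅ e ⁆ ∣      ≡⟨ ∣⁅x⁆∣≡1 e ⟩
        1              ≤⟨ ℕ.s≤s ℕ.z≤n ⟩
        suc (r ⊥)      ∎
      step : ∀ i X → i ∉ X → (e ∉ X → r (X ∪ ⁅ e ⁆) ℕ.≤ suc (r X)) →
             e ∉ X ∪ ⁅ i ⁆ → r ((X ∪ ⁅ i ⁆) ∪ ⁅ e ⁆) ℕ.≤ suc (r (X ∪ ⁅ i ⁆))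
      step i X i∉X ih e∉ = ℕₚ.+-cancelˡ-≤ (r X) _ _ (begin
        r X ℕ.+ r ((X ∪ ⁅ i ⁆) ∪ ⁅ e ⁆)  ≡⟨ cong (λ Z → r X ℕ.+ r Z) (solve ρ [] ((c ∨ b) ∨ a ≐ c ∨ (b ∨ a)) []) ⟩
        r X ℕ.+ r (X ∪ ⁅ i ⁆ ∪ ⁅ e ⁆)    ≤⟨ r-submodular X i e i∉X (#⇒∉ e#X) (#⇒≢ i#e) ⟩
        r (X ∪ ⁅ i ⁆) ℕ.+ r (X ∪ ⁅ e ⁆)  ≤⟨ ℕₚ.+-monoʳ-≤ (r (X ∪ ⁅ i ⁆)) (ih (#⇒∉ e#X)) ⟩
        r (X ∪ ⁅ i ⁆) ℕ.+ suc (r X)      ≡⟨ ℕₚ.+-suc _ _ ⟩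
        suc (r (X ∪ ⁅ i ⁆) ℕ.+ r X)      ≡⟨ cong suc (ℕₚ.+-comm (r (X ∪ ⁅ i ⁆)) (r X)) ⟩
        suc (r X ℕ.+ r (X ∪ ⁅ i ⁆))      ≡⟨ ℕₚ.+-suc _ _ ⟨
        r X ℕ.+ suc (r (X ∪ ⁅ i ⁆))      ∎)
        where
        ρ : Vec (Subset n) 3
        ρ = ⁅ e ⁆ ∷ ⁅ i ⁆ ∷ X ∷ []
        e#X : ⁅ e ⁆ # X
        e#X = solve ρ (a ⋕ c ∨ b ∷ []) (a ⋕ c) (∉⇒# e∉ ∷ [])
        i#e : ⁅ i ⁆ # ⁅ e ⁆
        i#e = solve ρ (a ⋕ c ∨ b ∷ []) (b ⋕ a) (∉⇒# e∉ ∷ [])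

    -- Ranks of complements, and loops

    R : Subset n → ℕ
    R B = r (∁ B)

    -- e is a loop of the dual matroid after contracting B, equivalently
    -- f∖B takes the value 1 at {e}.
    Loop NonLoop : Subset n → Fin n → Set
    Loop    B e = R B ≡ suc (R (B ∪ ⁅ e ⁆))
    NonLoop B e = R B ≡ R (B ∪ ⁅ e ⁆)

    R-insert : ∀ B e → ⁅ e ⁆ # B → R B ≡ r (∁ (B ∪ ⁅ e ⁆) ∪ ⁅ e ⁆)
    R-insert B e e#B = cong r (solve (⁅ e ⁆ ∷ B ∷ []) (a ⋕ b ∷ []) (~ b ≐ ~ (b ∨ a) ∨ a) (e#B ∷ []))

    R-unit : ∀ B e → ⁅ e ⁆ # B → R B ℕ.≤ suc (R (B ∪ ⁅ e ⁆))
    R-unit B e e#B = subst (ℕ._≤ suc (R (B ∪ ⁅ e ⁆))) (sym (R-insert B e e#B))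
      (r-unit e _ (#⇒∉ (solve (⁅ e ⁆ ∷ B ∷ []) [] (a ⋕ ~ (b ∨ a)) [])))

    -- By unit increase and monotonicity, `R` drops by 1 or 0 when `e` is inserted.
    loop? : ∀ B e → ⁅ e ⁆ # B → Loop B e ⊎ NonLoop B e
    loop? B e e#B with ℕₚ.m≤n⇒m<n∨m≡n (R-unit B e e#B)
    ... | inj₂ eq = inj₁ eq
    ... | inj₁ (ℕ.s≤s R≤) = inj₂ (ℕₚ.≤-antisym R≤ (subst (R (B ∪ ⁅ e ⁆) ℕ.≤_) (sym (R-insert B e e#B))
            (r-mono _ e (#⇒∉ (solve (⁅ e ⁆ ∷ B ∷ []) [] (a ⋕ ~ (b ∨ a)) [])))))

    -- By submodularity the drop of `R` caused by `e` does not shrink when `x` is inserted first,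
    -- and it cannot exceed 1. This preserves the loop hypothesis when `D-loop` enlarges `B`.
    loop-insert : ∀ B e x → ⁅ e ⁆ # B → ⁅ x ⁆ # B → ⁅ e ⁆ # ⁅ x ⁆ → Loop B e → Loop (B ∪ ⁅ x ⁆) e
    loop-insert B e x e#B x#B e#x loop =
      ℕₚ.≤-antisym (R-unit (B ∪ ⁅ x ⁆) e (solve ρ (a ⋕ b ∷ a ⋕ c ∷ []) (a ⋕ c ∨ b) (e#x ∷ e#B ∷ [])))
        (ℕₚ.+-cancelʳ-≤ (R (B ∪ ⁅ e ⁆)) _ _ (begin
          suc (r X) ℕ.+ R (B ∪ ⁅ e ⁆)         ≡⟨ ℕₚ.+-suc (r X) _ ⟨
          r X ℕ.+ suc (R (B ∪ ⁅ e ⁆))         ≡⟨ cong (r X ℕ.+_) loop ⟨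
          r X ℕ.+ R B                         ≡⟨ cong (λ Z → r X ℕ.+ r Z) (solve ρ (a ⋕ c ∷ b ⋕ c ∷ [])
                                                   (~ c ≐ ~ ((c ∨ b) ∨ a) ∨ (a ∨ b)) (e#B ∷ x#B ∷ [])) ⟩
          r X ℕ.+ r (X ∪ ⁅ e ⁆ ∪ ⁅ x ⁆)       ≤⟨ r-submodular X e x
                                                   (#⇒∉ (solve ρ [] (a ⋕ ~ ((c ∨ b) ∨ a)) []))
                                                   (#⇒∉ (solve ρ [] (b ⋕ ~ ((c ∨ b) ∨ a)) [])) (#⇒≢ e#x) ⟩
          r (X ∪ ⁅ e ⁆) ℕ.+ r (X ∪ ⁅ x ⁆)     ≡⟨ cong₂ (λ Y Z → r Y ℕ.+ r Z)
                                                   (solve ρ (a ⋕ b ∷ a ⋕ c ∷ []) (~ ((c ∨ b) ∨ a) ∨ a ≐ ~ (c ∨ b)) (e#x ∷ e#B ∷ []))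
                                                   (solve ρ (a ⋕ b ∷ b ⋕ c ∷ []) (~ ((c ∨ b) ∨ a) ∨ b ≐ ~ (c ∨ a)) (e#x ∷ x#B ∷ [])) ⟩
          R (B ∪ ⁅ x ⁆) ℕ.+ R (B ∪ ⁅ e ⁆)     ∎))
      where
      open ℕₚ.≤-Reasoning
      ρ : Vec (Subset n) 3
      ρ = ⁅ e ⁆ ∷ ⁅ x ⁆ ∷ B ∷ []
      X : Subset n
      X = ∁ ((B ∪ ⁅ x ⁆) ∪ ⁅ e ⁆)

    -- Subset sums and numerators of deletions

    S : Subset n → Carrier
    S B = sumSub ℝ B f

    S≢0 : ∀ B → S B ≢ 0#
    S≢0 B = subst (λ X → S X ≢ 0#) (compl-∁ ℝ B) (proj₁ (rankable (∁ B)))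

    -- Rankability at the complement of `B`, with the quotient cleared. The product is the same for
    -- all `B`, so `S` doubles exactly when `R` drops by 1.
    S-R : ∀ B → fromℕ (2 ^ R B) * S B ≡ S (full ℝ)
    S-R B = *⁻¹-solve (S≢0 B)
      (subst (λ X → S (full ℝ) * S X ⁻¹ ≡ fromℕ (2 ^ R B)) (compl-∁ ℝ B) (proj₂ (rankable (∁ B))))

    -- The power is a factor of the nonzero total sum.
    2^R≢0 : ∀ B → fromℕ (2 ^ R B) ≢ 0#
    2^R≢0 B eq = S≢0 (full ℝ) (trans (sym (S-R B)) (trans (cong (_* S B) eq) (zeroˡ (S B))))

    S-nonLoop : ∀ B e → NonLoop B e → S (B ∪ ⁅ e ⁆) ≡ S B
    S-nonLoop B e nonLoop = *-cancelˡ _ (2^R≢0 (B ∪ ⁅ e ⁆))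
      (trans (S-R (B ∪ ⁅ e ⁆)) (trans (sym (S-R B)) (cong (λ i → fromℕ (2 ^ i) * S B) nonLoop)))

    S-loop : ∀ B e → Loop B e → S (B ∪ ⁅ e ⁆) ≡ S B + S B
    S-loop B e loop = *-cancelˡ p (2^R≢0 (B ∪ ⁅ e ⁆)) (begin
      p * S (B ∪ ⁅ e ⁆)      ≡⟨ S-R (B ∪ ⁅ e ⁆) ⟩
      S (full ℝ)             ≡⟨ S-R B ⟨
      fromℕ (2 ^ R B) * S B  ≡⟨ cong (λ i → fromℕ (2 ^ i) * S B) loop ⟩
      fromℕ (2 ^ suc (R (B ∪ ⁅ e ⁆))) * S B  ≡⟨ cong (_* S B) (fromℕ-2^suc (R (B ∪ ⁅ e ⁆))) ⟩
      (p + p) * S B          ≡⟨ distribʳ _ _ _ ⟩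
      p * S B + p * S B      ≡⟨ distribˡ _ _ _ ⟨
      p * (S B + S B)        ∎)
      where
      open ≡-Reasoning
      p : Carrier
      p = fromℕ (2 ^ R (B ∪ ⁅ e ⁆))

    -- The numerator of the deletion of `B`. Left undivided, it satisfies the additive recursion
    -- `D-insert` for loops and non-loops alike.
    D : Subset n → Subset n → Carrier
    D B W = sumSub ℝ B (λ Z → f (W ∪ Z))

    D-⊥ : ∀ B → D B ⊥ ≡ S B
    D-⊥ B = sum-cong B λ Z → cong f (∪-identityˡ Z)

    D-insert : ∀ B e W → ⁅ e ⁆ # B → D (B ∪ ⁅ e ⁆) W ≡ D B W + D B (W ∪ ⁅ e ⁆)
    D-insert B e W e#B = trans (sum-insert B e (λ Z → f (W ∪ Z)) (#⇒∉ e#B))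
      (cong (D B W +_) (sum-cong B λ Z → cong f (solve (⁅ e ⁆ ∷ W ∷ Z ∷ []) [] (b ∨ (c ∨ a) ≐ (b ∨ a) ∨ c) [])))

    S+D-atom : ∀ B e → ⁅ e ⁆ # B → S B + D B ⁅ e ⁆ ≡ S (B ∪ ⁅ e ⁆)
    S+D-atom B e e#B = begin
      S B + D B ⁅ e ⁆            ≡⟨ cong₂ (λ s X → s + D B X) (D-⊥ B) (∪-identityˡ ⁅ e ⁆) ⟨
      D B ⊥ + D B (⊥ ∪ ⁅ e ⁆)    ≡⟨ D-insert B e ⊥ e#B ⟨
      D (B ∪ ⁅ e ⁆) ⊥            ≡⟨ D-⊥ (B ∪ ⁅ e ⁆) ⟩
      S (B ∪ ⁅ e ⁆)              ∎
      where open ≡-Reasoning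

    D-nonLoop-atom : ∀ B e → ⁅ e ⁆ # B → NonLoop B e → D B ⁅ e ⁆ ≡ 0#
    D-nonLoop-atom B e e#B nonLoop = +-cancelˡ (S B) _ _
      (trans (S+D-atom B e e#B) (trans (S-nonLoop B e nonLoop) (sym (+-identityʳ (S B)))))

    -- Adding i to W is reduced, via D-insert, to the same claim with i moved into B.
    D-loop : ∀ e W B → ⁅ e ⁆ # W → ⁅ e ⁆ # B → W # B → Loop B e → D B (W ∪ ⁅ e ⁆) ≡ D B W
    D-loop e = subset-induction
      (λ W → ∀ B → ⁅ e ⁆ # W → ⁅ e ⁆ # B → W # B → Loop B e → D B (W ∪ ⁅ e ⁆) ≡ D B W) base step
      where
      base : ∀ B → ⁅ e ⁆ # ⊥ → ⁅ e ⁆ # B → ⊥ # B → Loop B e → D B (⊥ ∪ ⁅ e ⁆) ≡ D B ⊥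
      base B _ e#B _ loop = begin
        D B (⊥ ∪ ⁅ e ⁆)  ≡⟨ cong (D B) (∪-identityˡ ⁅ e ⁆) ⟩
        D B ⁅ e ⁆        ≡⟨ +-cancelˡ (S B) _ _ (trans (S+D-atom B e e#B) (S-loop B e loop)) ⟩
        S B              ≡⟨ D-⊥ B ⟨
        D B ⊥            ∎
        where open ≡-Reasoning
      step : ∀ i W → i ∉ W →
             (∀ B → ⁅ e ⁆ # W → ⁅ e ⁆ # B → W # B → Loop B e → D B (W ∪ ⁅ e ⁆) ≡ D B W) →
             ∀ B → ⁅ e ⁆ # W ∪ ⁅ i ⁆ → ⁅ e ⁆ # B → W ∪ ⁅ i ⁆ # B → Loop B e →
             D B ((W ∪ ⁅ i ⁆) ∪ ⁅ e ⁆) ≡ D B (W ∪ ⁅ i ⁆)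
      step i W i∉W ih B e#Wi e#B Wi#B loop = +-cancelˡ (D B W) _ _ (begin
        D B W + D B ((W ∪ ⁅ i ⁆) ∪ ⁅ e ⁆)
          ≡⟨ cong₂ (λ s X → s + D B X) (sym (ih B e#W e#B (solve ρ (c ∨ b ⋕ d ∷ []) (c ⋕ d) (Wi#B ∷ [])) loop))
               (solve ρ [] ((c ∨ b) ∨ a ≐ (c ∨ a) ∨ b) []) ⟩
        D B (W ∪ ⁅ e ⁆) + D B ((W ∪ ⁅ e ⁆) ∪ ⁅ i ⁆)  ≡⟨ D-insert B i (W ∪ ⁅ e ⁆) i#B ⟨
        D (B ∪ ⁅ i ⁆) (W ∪ ⁅ e ⁆)
          ≡⟨ ih (B ∪ ⁅ i ⁆) e#W (solve ρ (a ⋕ c ∨ b ∷ a ⋕ d ∷ []) (a ⋕ d ∨ b) (e#Wi ∷ e#B ∷ []))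
               (solve ρ (b ⋕ c ∷ c ∨ b ⋕ d ∷ []) (c ⋕ d ∨ b) (∉⇒# i∉W ∷ Wi#B ∷ []))
               (loop-insert B e i e#B i#B (solve ρ (a ⋕ c ∨ b ∷ []) (a ⋕ b) (e#Wi ∷ [])) loop) ⟩
        D (B ∪ ⁅ i ⁆) W                              ≡⟨ D-insert B i W i#B ⟩
        D B W + D B (W ∪ ⁅ i ⁆)                      ∎)
        where
        open ≡-Reasoning
        ρ : Vec (Subset n) 4
        ρ = ⁅ e ⁆ ∷ ⁅ i ⁆ ∷ W ∷ B ∷ []
        e#W : ⁅ e ⁆ # W
        e#W = solve ρ (a ⋕ c ∨ b ∷ []) (a ⋕ c) (e#Wi ∷ [])
        i#B : ⁅ i ⁆ # B
        i#B = solve ρ (c ∨ b ⋕ d ∷ []) (b ⋕ d) (Wi#B ∷ [])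

    -- Normalised deletions and the induction

    h : Subset n → Subset n → Carrier
    h = contractDelete ℝ f

    h-⊥ : ∀ B → h B ⊥ ≡ 1#
    h-⊥ B = trans (cong (_* S B ⁻¹) (D-⊥ B)) (⁻¹-inverse (S B) (S≢0 B))

    -- A non-loop leaves the denominator unchanged, so the recursion for numerators passes to the
    -- quotients.
    h-deleted : ∀ B e W → ⁅ e ⁆ # B → NonLoop B e → h (B ∪ ⁅ e ⁆) W ≡ h B W + h B (W ∪ ⁅ e ⁆)
    h-deleted B e W e#B nonLoop =
      trans (cong₂ (λ x s → x * s ⁻¹) (D-insert B e W e#B) (S-nonLoop B e nonLoop)) (distribʳ _ _ _)

    -- By `D-loop` the value at a set does not depend on whether `e` belongs to it, and removing `e`
    -- commutes with symmetric difference.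
    linearOn-loop : ∀ A B e → A # B → ⁅ e ⁆ ⊑ A → Loop B e → LinearOn (h B) (A ∖ ⁅ e ⁆) → LinearOn (h B) A
    linearOn-loop A B e A#B e⊑A loop (bit , closed) =
        (λ W W⊑A → subst Bit (sym (drop W W⊑A)) (bit (W ∖ ⁅ e ⁆) (below W W⊑A)))
      , λ U V U⊑A V⊑A hU hV → trans
          (drop (U △ V) (solve (U ∷ V ∷ A ∷ []) (a ≼ c ∷ b ≼ c ∷ []) (a ⊕ b ≼ c) (U⊑A ∷ V⊑A ∷ [])))
          (trans (cong (h B) (solve (U ∷ V ∷ ⁅ e ⁆ ∷ []) [] ((a ⊕ b) ∧ ~ c ≐ (a ∧ ~ c) ⊕ (b ∧ ~ c)) []))
            (closed (U ∖ ⁅ e ⁆) (V ∖ ⁅ e ⁆) (below U U⊑A) (below V V⊑A)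
              (trans (sym (drop U U⊑A)) hU) (trans (sym (drop V V⊑A)) hV)))
      where
      below : ∀ W → W ⊑ A → W ∖ ⁅ e ⁆ ⊑ A ∖ ⁅ e ⁆
      below W W⊑A = solve (⁅ e ⁆ ∷ W ∷ A ∷ []) (b ≼ c ∷ []) (b ∧ ~ a ≼ c ∧ ~ a) (W⊑A ∷ [])
      drop : ∀ W → W ⊑ A → h B W ≡ h B (W ∖ ⁅ e ⁆)
      drop W W⊑A with atom? e W
      ... | inj₂ e#W = cong (h B) (solve (⁅ e ⁆ ∷ W ∷ []) (a ⋕ b ∷ []) (b ≐ b ∧ ~ a) (e#W ∷ []))
      ... | inj₁ e⊑W = trans
              (cong (h B) (solve (⁅ e ⁆ ∷ W ∷ []) (a ≼ b ∷ []) (b ≐ (b ∧ ~ a) ∨ a) (e⊑W ∷ [])))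
              (cong (_* S B ⁻¹) (D-loop e (W ∖ ⁅ e ⁆) B
                (solve (⁅ e ⁆ ∷ W ∷ []) [] (a ⋕ b ∧ ~ a) [])
                (solve ρ (a ≼ c ∷ c ⋕ d ∷ []) (a ⋕ d) (e⊑A ∷ A#B ∷ []))
                (solve ρ (b ≼ c ∷ c ⋕ d ∷ []) (b ∧ ~ a ⋕ d) (W⊑A ∷ A#B ∷ [])) loop))
        where
        ρ : Vec (Subset n) 4
        ρ = ⁅ e ⁆ ∷ W ∷ A ∷ B ∷ []

    U24⇒minor : ∀ A B → A # B → IsU24On (h B) A → HasMinorIsoTo ℝ f (fU24 ℝ)
    U24⇒minor A B A#B u =
        -- Contracting all that lies outside `A` and `B` leaves `A` as the ground set of the minor.
        ∁ (A ∪ B) , B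
      , solve (A ∷ B ∷ []) [] (~ (a ∨ b) ⋕ b) []
      , S≢0 B
      , φ , injective
      , (λ i → #⇒∉ (solve (⁅ φ i ⁆ ∷ A ∷ B ∷ []) (a ≼ b ∷ []) (a ⋕ ~ (b ∨ c)) (inside i ∷ []))
             , #⇒∉ (solve (⁅ φ i ⁆ ∷ A ∷ B ∷ []) (a ≼ b ∷ b ⋕ c ∷ []) (a ⋕ c) (inside i ∷ A#B ∷ [])))
      , (λ e e∉X e∉B → surjective e (solve (⁅ e ⁆ ∷ A ∷ B ∷ []) (a ⋕ ~ (b ∨ c) ∷ a ⋕ c ∷ []) (a ≼ b)
             (∉⇒# e∉X ∷ ∉⇒# e∉B ∷ [])))
      , values
      where open IsU24On u

    module _ (noMinor : ¬ HasMinorIsoTo ℝ f (fU24 ℝ)) where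

      -- The strict bound `m` makes the recursion structural and rules out `m` being zero. The set
      -- `B` must vary, because deleting an element moves it from `A` to `B`, while contracting it
      -- only removes it from `A`.
      linearOn : ∀ m A B → ∣ A ∣ ℕ.< m → A # B → LinearOn (h B) A
      linearOn (suc m) A B (ℕ.s≤s ∣A∣≤m) A#B with Finₚ.any? (λ e → (e ∈? A) ×-dec (R B ℕ.≟ suc (R (B ∪ ⁅ e ⁆))))
      ... | yes (e , e∈A , loop) = linearOn-loop A B e A#B (∈⇒⊑ e∈A) loop (linearOn m (A ∖ ⁅ e ⁆) B
              (ℕₚ.<-≤-trans (∣∖∣<∣∣ A e (∈⇒⊑ e∈A)) ∣A∣≤m)
              (solve (⁅ e ⁆ ∷ A ∷ B ∷ []) (b ⋕ c ∷ []) (b ∧ ~ a ⋕ c) (A#B ∷ [])))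
      ... | no noLoop with Loopless.linear-or-U24 (h B) A (h-⊥ B) atom contracted deleted
        where
        smaller : ∀ e → ⁅ e ⁆ ⊑ A → ∣ A ∖ ⁅ e ⁆ ∣ ℕ.< m
        smaller e e⊑A = ℕₚ.<-≤-trans (∣∖∣<∣∣ A e e⊑A) ∣A∣≤m
        e#B : ∀ e → ⁅ e ⁆ ⊑ A → ⁅ e ⁆ # B
        e#B e e⊑A = solve (⁅ e ⁆ ∷ A ∷ B ∷ []) (a ≼ b ∷ b ⋕ c ∷ []) (a ⋕ c) (e⊑A ∷ A#B ∷ [])
        nonLoop : ∀ e → ⁅ e ⁆ ⊑ A → NonLoop B e
        nonLoop e e⊑A with loop? B e (e#B e e⊑A)
        ... | inj₁ loop = contradiction (e , ⊑⇒∈ e⊑A , loop) noLoop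
        ... | inj₂ nl   = nl
        atom : ∀ e → ⁅ e ⁆ ⊑ A → h B ⁅ e ⁆ ≡ 0#
        atom e e⊑A = trans (cong (_* S B ⁻¹) (D-nonLoop-atom B e (e#B e e⊑A) (nonLoop e e⊑A))) (zeroˡ _)
        contracted : ∀ e → ⁅ e ⁆ ⊑ A → LinearOn (h B) (A ∖ ⁅ e ⁆)
        contracted e e⊑A = linearOn m (A ∖ ⁅ e ⁆) B (smaller e e⊑A)
          (solve (⁅ e ⁆ ∷ A ∷ B ∷ []) (b ⋕ c ∷ []) (b ∧ ~ a ⋕ c) (A#B ∷ []))
        deleted : ∀ e → ⁅ e ⁆ ⊑ A → LinearOn (λ W → h B W + h B (W ∪ ⁅ e ⁆)) (A ∖ ⁅ e ⁆)
        deleted e e⊑A = linearOn-cong (λ W → h-deleted B e W (e#B e e⊑A) (nonLoop e e⊑A))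
          (linearOn m (A ∖ ⁅ e ⁆) (B ∪ ⁅ e ⁆) (smaller e e⊑A)
            (solve (⁅ e ⁆ ∷ A ∷ B ∷ []) (b ⋕ c ∷ []) (b ∧ ~ a ⋕ c ∨ a) (A#B ∷ [])))
      ...   | inj₁ linear = linear
      ...   | inj₂ u24    = contradiction (U24⇒minor A B A#B u24) noMinor

      linear : Linear ℝ f
      -- Nothing is deleted or contracted here, and the denominator is `f ⊥`, which is 1.
      linear = linearOn⇒linear (linearOn-cong h≡f (linearOn (suc ∣ ⊤ {n} ∣) ⊤ ⊥ ℕₚ.≤-refl (∩-zeroʳ ⊤)))
        where
        h≡f : ∀ W → h ⊥ W ≡ f W
        h≡f W = *-cancelˡ (S ⊥) (S≢0 ⊥) (begin
          S ⊥ * h ⊥ W         ≡⟨ *-comm (S ⊥) _ ⟩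
          h ⊥ W * S ⊥         ≡⟨ *⁻¹-solve (S≢0 ⊥) refl ⟩
          D ⊥ W               ≡⟨ sum-⊥ (λ Z → f (W ∪ Z)) ⟩
          f (W ∪ ⊥)           ≡⟨ cong f (∪-identityʳ W) ⟩
          f W                 ≡⟨ *-identityˡ (f W) ⟨
          1# * f W            ≡⟨ cong (_* f W) (trans (sum-⊥ f) f-⊥) ⟨
          S ⊥ * f W           ∎)
          where open ≡-Reasoning

  -- At the full four-element set the numerator would be the negative of the denominator. Both are
  -- sums of nonnegative terms and the denominator is nonzero, so their sum is positive and cannot
  -- vanish.
  linear⇒noMinor : ∀ (f : Subset n → Carrier) → Linear ℝ f → ¬ HasMinorIsoTo ℝ f (fU24 ℝ)
  linear⇒noMinor f (bit , _) (X , Y , _ , S≢0 , φ , _ , _ , _ , values)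
    with sum-nonNeg Y (λ Z → bit-nonNeg (bit Z))
  ... | inj₁ S≡0 = S≢0 S≡0
  ... | inj₂ 0<S = pos⇒≢0 (pos+nonNeg 0<S (sum-nonNeg Y (λ Z → bit-nonNeg (bit (image φ ⊤ ∪ Z))))) S+D≡0
    where
    S+D≡0 : sumSub ℝ Y f + sumSub ℝ Y (λ Z → f (image φ ⊤ ∪ Z)) ≡ 0#
    S+D≡0 = trans (cong (sumSub ℝ Y f +_) (trans (sym (*⁻¹-solve S≢0 (sym (values ⊤)))) (-1*x≈-x _))) (-‿inverseʳ _)

theorem13 : (ℝ : RealField) (n : ℕ) (f : Subset n → RealField.Carrier ℝ) →
    IsBinaryFunction ℝ f → Matroidal ℝ f →
    (Linear ℝ f → ¬ HasMinorIsoTo ℝ f (fU24 ℝ)) × (¬ HasMinorIsoTo ℝ f (fU24 ℝ) → Linear ℝ f)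
theorem13 ℝ n f f-⊥ (r , rankable , matroid) =
  linear⇒noMinor f , MatroidalFunction.linear f f-⊥ r rankable matroid
  where open RealProperties ℝ
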